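{- Let $m, n$ be positive integers. If $B \in \{+1,-1\}^{m\times n}$ is chosen uniformly at random among all $m\times n$ matrices with entries in $\{+1,-1\}$, then $$E(\det(BB^T)) = m!\binom{n}{m}.$$
   Context: $E$ denotes expectation with respect to the uniform distribution on the $2^{mn}$ matrices in $\{+1,-1\}^{m\times n}$. -}

module Defs where

open import Data.Fin.Base using (Fin; zero; suc; toℕ)
open import Data.Integer.Base using (ℤ; _+_; _*_; _^_; 0ℤ; 1ℤ; -1ℤ; _◃_)
open import Data.Integer.Properties using (+-*-semiring)
open import Data.List.Base
  using (List; []; _∷_; length; map; foldr; cartesianProductWith)
open import Data.List.Membership.Propositional using (_∈_)
open import Data.List.Membership.Propositional.Properties
  using (∈-cartesianProductWith⁺)
open import Data.List.Properties using (length-++; length-map)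
open import Data.List.Relation.Unary.All using ([]; _∷_)
open import Data.List.Relation.Unary.AllPairs using ([]; _∷_)
open import Data.List.Relation.Unary.Any using (here; there)
open import Data.List.Relation.Unary.Unique.Propositional using (Unique)
open import Data.List.Relation.Unary.Unique.Propositional.Properties
  using (cartesianProductWith⁺)
open import Data.Nat.Base as ℕ using (ℕ; zero; suc)
open import Data.Nat.Properties as ℕ using (m^n≢0)
open import Data.Product.Base using (_,_)
open import Data.Rational.Base using (ℚ; _/_)
open import Data.Sign.Base as Sign using (Sign)
open import Data.Vec.Base using (Vec; []; _∷_; lookup)
open import Data.Vec.Functional using (Vector; tail; removeAt; transpose)
import Data.Vec.Functional as VF
open import Data.Vec.Properties using (∷-injective)
open import Relation.Binary.PropositionalEquality
  using (_≡_; refl; trans; cong; cong₂)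

open import Algebra.Properties.Semiring.Sum +-*-semiring using (sum)

Matrix : ℕ → ℕ → Set
Matrix m n = Vector (Vector ℤ n) m

infix 9 _ᵀ
_ᵀ : ∀ {m n} → Matrix m n → Matrix n m
_ᵀ = transpose

infixl 7 _·_
_·_ : ∀ {m n p} → Matrix m n → Matrix n p → Matrix m p
(A · B) i k = sum λ j → A i j * B j k

-- Laplace expansion along the first row; the empty determinant is 1.
det : ∀ {n} → Matrix n n → ℤ
det {zero}  A = 1ℤ
det {suc n} A = sum λ j → -1ℤ ^ toℕ j * A zero j * det (minor j)
  where
  minor : Fin (suc n) → Matrix n n
  minor j = VF.map (λ row → removeAt row j) (tail A)

-- {+1,-1}^{m×n}.  Vectors rather than functions, so that propositional
-- equality is entrywise equality and the type has exactly 2^(mn) elements.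
SignMatrix : ℕ → ℕ → Set
SignMatrix m n = Vec (Vec Sign n) m

toMatrix : ∀ {m n} → SignMatrix m n → Matrix m n
toMatrix B i j = lookup (lookup B i) j ◃ 1

allVecs : ∀ {A : Set} → List A → (n : ℕ) → List (Vec A n)
allVecs xs zero    = [] ∷ []
allVecs xs (suc n) = cartesianProductWith _∷_ xs (allVecs xs n)

signs : List Sign
signs = Sign.+ ∷ Sign.- ∷ []

allSignMatrices : (m n : ℕ) → List (SignMatrix m n)
allSignMatrices m n = allVecs (allVecs signs n) m

E : ∀ {m n} → (SignMatrix m n → ℤ) → ℚ
E {m} {n} X =
  _/_ (foldr _+_ 0ℤ (map X (allSignMatrices m n)))
      (2 ℕ.^ (m ℕ.* n)) {{m^n≢0 2 (m ℕ.* n)}}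

-- The enumeration lists every sign matrix exactly once, and there are
-- 2^(mn) of them, so E is the mean under the uniform distribution.

allVecs-complete : ∀ {A : Set} {xs : List A} → (∀ x → x ∈ xs) →
                   ∀ {n} (v : Vec A n) → v ∈ allVecs xs n
allVecs-complete c []      = here refl
allVecs-complete c (x ∷ v) =
  ∈-cartesianProductWith⁺ _∷_ (c x) (allVecs-complete c v)

allVecs-unique : ∀ {A : Set} {xs : List A} → Unique xs →
                 ∀ n → Unique (allVecs xs n)
allVecs-unique u zero    = [] ∷ []
allVecs-unique u (suc n) =
  cartesianProductWith⁺ _∷_ ∷-injective u (allVecs-unique u n)

length-cartesianProductWith :
  ∀ {A B C : Set} (f : A → B → C) xs ys →
  length (cartesianProductWith f xs ys) ≡ length xs ℕ.* length ys
length-cartesianProductWith f []       ys = refl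
length-cartesianProductWith f (x ∷ xs) ys =
  trans (length-++ (map (f x) ys))
        (cong₂ ℕ._+_ (length-map (f x) ys) (length-cartesianProductWith f xs ys))

length-allVecs : ∀ {A : Set} (xs : List A) n →
                 length (allVecs xs n) ≡ length xs ℕ.^ n
length-allVecs xs zero    = refl
length-allVecs xs (suc n) =
  trans (length-cartesianProductWith _∷_ xs (allVecs xs n))
        (cong (length xs ℕ.*_) (length-allVecs xs n))

signs-complete : ∀ s → s ∈ signs
signs-complete Sign.+ = here refl
signs-complete Sign.- = there (here refl)

signs-unique : Unique signs
signs-unique = ((λ ()) ∷ []) ∷ [] ∷ []

allSignMatrices-complete : ∀ {m n} (B : SignMatrix m n) →
                           B ∈ allSignMatrices m n
allSignMatrices-complete = allVecs-complete (allVecs-complete signs-complete)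

allSignMatrices-unique : ∀ m n → Unique (allSignMatrices m n)
allSignMatrices-unique m n = allVecs-unique (allVecs-unique signs-unique n) m

length-allSignMatrices : ∀ m n →
                         length (allSignMatrices m n) ≡ 2 ℕ.^ (m ℕ.* n)
length-allSignMatrices m n =
  trans (length-allVecs (allVecs signs n) m)
  (trans (cong (ℕ._^ m) (length-allVecs signs n))
  (trans (ℕ.^-*-assoc 2 n m) (cong (2 ℕ.^_) (ℕ.*-comm n m))))

{-# OPTIONS --safe #-}
module Submission where

-- Reveal the rows of B one at a time.  Let G be the Gram matrix of m given rows
-- and G⁺ the one obtained by adjoining a uniformly random sign row r.  Expanding
-- det G⁺ along its first row and first column gives
--   det G⁺ = ⟨r,r⟩ det G − Σᵢⱼ ⟨r,bᵢ⟩⟨r,bⱼ⟩ cofactorᵢⱼ(G).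
-- Here ⟨r,r⟩ = n, and the mean of ⟨r,bᵢ⟩⟨r,bⱼ⟩ is ⟨bᵢ,bⱼ⟩ = Gᵢⱼ, so by Laplace
-- expansion along each of the m rows of G the mean of det G⁺ is (n − m) det G.
-- Hence the expectation is the falling factorial n (n − 1) ⋯ (n − m + 1).

open import Defs
open import Data.Nat.Base using (ℕ; NonZero; _*_; _!)
open import Data.Nat.Combinatorics using (_C_)
open import Data.Integer.Base using (+_)
open import Data.Rational.Base using (_/_)
open import Relation.Binary.PropositionalEquality using (_≡_)

import Algebra.Properties.Semiring.Sum
open import Data.Bool.Base using (true)
open import Data.Fin.Base using (Fin; zero; suc; toℕ; punchIn; pinch)
open import Data.Integer.Base as ℤ using (ℤ; 0ℤ; 1ℤ; -1ℤ; -_; _-_; _◃_)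
  renaming (_+_ to _+ᶻ_; _*_ to _*ᶻ_)
import Data.Integer.Properties as ℤ
open import Data.Integer.Tactic.RingSolver using (solve-∀)
open import Data.List.Base using (List; []; _∷_; _++_; map; foldr; cartesianProductWith)
open import Data.Nat.Base as ℕ using (zero; suc; _∸_; _^_; _≤_; s≤s)
open import Data.Nat.Combinatorics using (nCk≡nPk/k!; k>n⇒nCk≡0)
open import Data.Nat.Combinatorics.Base using (_P_; _P′_)
open import Data.Nat.Combinatorics.Specification using (k!∣nP′k)
open import Data.Nat.DivMod using (m*[n/m]≡n)
import Data.Nat.Properties as ℕ
import Data.Rational.Properties as ℚ
open import Data.Rational.Unnormalised.Base using (mkℚᵘ; *≡*)
open import Data.Sign.Base as Sign using (Sign)
open import Data.Sum.Base using (inj₁; inj₂)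
open import Data.Vec.Base using (Vec; []; _∷_; lookup)
open import Relation.Binary.PropositionalEquality
  using (refl; sym; trans; cong; cong₂; module ≡-Reasoning)

private
  module Σ = Algebra.Properties.Semiring.Sum ℤ.+-*-semiring

open Σ using (sum-syntax)
open ≡-Reasoning

-- Determinants

sgn : ∀ {n} → Fin n → ℤ
sgn i = -1ℤ ℤ.^ toℕ i

minor : ∀ {m n} → Matrix (suc m) (suc n) → Fin (suc m) → Fin (suc n) → Matrix m n
minor M i j a b = M (punchIn i a) (punchIn j b)

-- The sign is kept as a row factor times a column factor, so that column signs can be exchanged
-- while the row sign is carried along.
cofactor : ∀ {n} → Matrix n n → Fin n → Fin n → ℤ
cofactor {suc n} M i j = sgn i *ᶻ sgn j *ᶻ det (minor M i j)

-- Matrices are functions, so this stands in for extensionality, in particular when two iterated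
-- minors agree only entrywise.
det-cong : ∀ {n} {A B : Matrix n n} → (∀ i j → A i j ≡ B i j) → det A ≡ det B
det-cong {zero}  A≗B = refl
det-cong {suc n} A≗B = Σ.sum-cong-≗ λ j →
  cong₂ _*ᶻ_ (cong (sgn j *ᶻ_) (A≗B zero j))
              (det-cong λ a b → A≗B (suc a) (punchIn j b))

-- (j , k) ↦ (punchIn j k , pinch k j) is the involution that exchanges the
-- two entries of an ordered pair of distinct indices (j , punchIn j k).
∑-swap : ∀ {n} (f : Fin (suc n) → Fin n → ℤ) →
         (∑[ j < suc n ] ∑[ k < n ] f j k) ≡
         (∑[ j < suc n ] ∑[ k < n ] f (punchIn j k) (pinch k j))
∑-swap {zero}  f = refl
∑-swap {suc n} f = begin
  a +ᶻ ∑[ j < suc n ] (f (suc j) zero +ᶻ ∑[ k < n ] f (suc j) (suc k))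
    ≡⟨ cong (a +ᶻ_) (Σ.∑-distrib-+ (λ j → f (suc j) zero) (λ j → ∑[ k < n ] f (suc j) (suc k))) ⟩
  a +ᶻ (b +ᶻ ∑[ j < suc n ] ∑[ k < n ] f (suc j) (suc k))
    ≡⟨ cong (λ c → a +ᶻ (b +ᶻ c)) (∑-swap λ j k → f (suc j) (suc k)) ⟩
  a +ᶻ (b +ᶻ c)
    ≡⟨ exchange a b c ⟩
  b +ᶻ (a +ᶻ c)
    ≡⟨ cong (b +ᶻ_) (Σ.∑-distrib-+ (f zero) (λ j → ∑[ k < n ] f (suc (punchIn j k)) (suc (pinch k j)))) ⟨
  b +ᶻ ∑[ j < suc n ] (f zero j +ᶻ ∑[ k < n ] f (suc (punchIn j k)) (suc (pinch k j)))
    ∎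
  where
  a = ∑[ k < suc n ] f zero k
  b = ∑[ j < suc n ] f (suc j) zero
  c = ∑[ j < suc n ] ∑[ k < n ] f (suc (punchIn j k)) (suc (pinch k j))
  exchange : ∀ x y z → x +ᶻ (y +ᶻ z) ≡ y +ᶻ (x +ᶻ z)
  exchange = solve-∀

-- The second entry of the exchanged pair is the old first entry.
punchIn-swap : ∀ {n} (j : Fin (suc n)) (k : Fin n) →
               punchIn (punchIn j k) (pinch k j) ≡ j
punchIn-swap {suc n} zero    k       = refl
punchIn-swap {suc n} (suc j) zero    = refl
punchIn-swap {suc n} (suc j) (suc k) = cong suc (punchIn-swap j k)

-- Deleting the same two columns in either order leaves the same columns in the same order.
punchIn-punchIn : ∀ {n} (j : Fin (suc (suc n))) (k : Fin (suc n)) (x : Fin n) →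
                  punchIn j (punchIn k x) ≡
                  punchIn (punchIn j k) (punchIn (pinch k j) x)
punchIn-punchIn zero    k       x       = refl
punchIn-punchIn (suc j) zero    x       = refl
punchIn-punchIn (suc j) (suc k) zero    = refl
punchIn-punchIn (suc j) (suc k) (suc x) = cong suc (punchIn-punchIn j k x)

-- Of two distinct columns, the larger has its position lowered by one exactly when the smaller is
-- deleted first, so exchanging the order changes the sum of the positions by one.
sgn-swap : ∀ {n} (j : Fin (suc n)) (k : Fin n) →
           sgn (punchIn j k) *ᶻ sgn (pinch k j) ≡ - (sgn j *ᶻ sgn k)
sgn-swap {suc n} zero    k       = lemma (sgn k)
  where
  lemma : ∀ x → -1ℤ *ᶻ x *ᶻ 1ℤ ≡ - (1ℤ *ᶻ x)
  lemma = solve-∀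
sgn-swap {suc n} (suc j) zero    = lemma (sgn j)
  where
  lemma : ∀ x → 1ℤ *ᶻ x ≡ - (-1ℤ *ᶻ x *ᶻ 1ℤ)
  lemma = solve-∀
sgn-swap {suc n} (suc j) (suc k) = begin
  -1ℤ *ᶻ sgn (punchIn j k) *ᶻ (-1ℤ *ᶻ sgn (pinch k j))  ≡⟨ lemma (sgn (punchIn j k)) (sgn (pinch k j)) ⟩
  sgn (punchIn j k) *ᶻ sgn (pinch k j)                    ≡⟨ sgn-swap j k ⟩
  - (sgn j *ᶻ sgn k)                                      ≡⟨ cong -_ (lemma (sgn j) (sgn k)) ⟨
  - (-1ℤ *ᶻ sgn j *ᶻ (-1ℤ *ᶻ sgn k))                    ∎
  where
  lemma : ∀ x y → -1ℤ *ᶻ x *ᶻ (-1ℤ *ᶻ y) ≡ x *ᶻ y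
  lemma = solve-∀

-- Expanding along row `zero` and then, inductively, along row `i` of each minor gives a sum over
-- ordered pairs of distinct columns. Exchanging the pair costs a sign, which turns `sgn i` into
-- `sgn (suc i)`.
det-expand-row : ∀ {n} (M : Matrix n n) (i : Fin n) →
                 det M ≡ ∑[ j < n ] (M i j *ᶻ cofactor M i j)
det-expand-row {suc n} M zero = Σ.sum-cong-≗ λ j → lemma (sgn j) (M zero j) (det (minor M zero j))
  where
  lemma : ∀ s x d → s *ᶻ x *ᶻ d ≡ x *ᶻ (1ℤ *ᶻ s *ᶻ d)
  lemma = solve-∀
det-expand-row {suc (suc n)} M (suc i) = begin
  ∑[ j < suc (suc n) ] (sgn j *ᶻ M zero j *ᶻ det (minor M zero j))
    ≡⟨ Σ.sum-cong-≗ (λ j → trans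
         (cong (sgn j *ᶻ M zero j *ᶻ_) (det-expand-row (minor M zero j) i))
         (Σ.*-distribˡ-sum (sgn j *ᶻ M zero j) λ k → M (suc i) (punchIn j k) *ᶻ cofactor (minor M zero j) i k)) ⟩
  ∑[ j < suc (suc n) ] ∑[ k < suc n ] f j k
    -- From here on `j` is the column used in row `suc i`, and `k` locates the column used in row
    -- `zero`.
    ≡⟨ ∑-swap f ⟩
  ∑[ j < suc (suc n) ] ∑[ k < suc n ] f (punchIn j k) (pinch k j)
    ≡⟨ Σ.sum-cong-≗ (λ j → Σ.sum-cong-≗ (f-swap j)) ⟩
  ∑[ j < suc (suc n) ] ∑[ k < suc n ] (M (suc i) j *ᶻ (sgn (suc i) *ᶻ sgn j) *ᶻ g j k)
    -- The values of `g j` are by definition the terms of the first-row expansion of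
    -- `det (minor M (suc i) j)`.
    ≡⟨ Σ.sum-cong-≗ (λ j → Σ.*-distribˡ-sum (M (suc i) j *ᶻ (sgn (suc i) *ᶻ sgn j)) (g j)) ⟨
  ∑[ j < suc (suc n) ] (M (suc i) j *ᶻ (sgn (suc i) *ᶻ sgn j) *ᶻ det (minor M (suc i) j))
    ≡⟨ Σ.sum-cong-≗ (λ j → ℤ.*-assoc (M (suc i) j) (sgn (suc i) *ᶻ sgn j) (det (minor M (suc i) j))) ⟩
  ∑[ j < suc (suc n) ] (M (suc i) j *ᶻ cofactor M (suc i) j)
    ∎
  where
  f g : Fin (suc (suc n)) → Fin (suc n) → ℤ
  f j k = sgn j *ᶻ M zero j *ᶻ (M (suc i) (punchIn j k) *ᶻ cofactor (minor M zero j) i k)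
  g j k = sgn k *ᶻ M zero (punchIn j k) *ᶻ det (minor (minor M (suc i) j) zero k)

  lemma₁ : ∀ s x y t u d → s *ᶻ x *ᶻ (y *ᶻ (t *ᶻ u *ᶻ d)) ≡ x *ᶻ y *ᶻ t *ᶻ (s *ᶻ u) *ᶻ d
  lemma₁ = solve-∀

  lemma₂ : ∀ s x y t u d → x *ᶻ y *ᶻ t *ᶻ (- (s *ᶻ u)) *ᶻ d ≡ y *ᶻ (-1ℤ *ᶻ t *ᶻ s) *ᶻ (u *ᶻ x *ᶻ d)
  lemma₂ = solve-∀

  f-swap : ∀ j k → f (punchIn j k) (pinch k j) ≡
                   M (suc i) j *ᶻ (sgn (suc i) *ᶻ sgn j) *ᶻ g j k
  f-swap j k = begin
    f j′ k′
      ≡⟨ lemma₁ (sgn j′) (M zero j′) (M (suc i) (punchIn j′ k′)) (sgn i) (sgn k′) _ ⟩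
    M zero j′ *ᶻ M (suc i) (punchIn j′ k′) *ᶻ sgn i *ᶻ (sgn j′ *ᶻ sgn k′) *ᶻ det (minor (minor M zero j′) i k′)
      ≡⟨ cong₂ _*ᶻ_
           (cong₂ (λ l s → M zero j′ *ᶻ M (suc i) l *ᶻ sgn i *ᶻ s) (punchIn-swap j k) (sgn-swap j k))
           (det-cong λ a b → cong (M (suc (punchIn i a))) (sym (punchIn-punchIn j k b))) ⟩
    M zero j′ *ᶻ M (suc i) j *ᶻ sgn i *ᶻ (- (sgn j *ᶻ sgn k)) *ᶻ det (minor (minor M (suc i) j) zero k)
      ≡⟨ lemma₂ (sgn j) (M zero j′) (M (suc i) j) (sgn i) (sgn k) _ ⟩
    M (suc i) j *ᶻ (sgn (suc i) *ᶻ sgn j) *ᶻ g j k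
      ∎
    where
    j′ = punchIn j k
    k′ = pinch k j

mutual
  -- After the first-row expansion, each minor that keeps the first column is expanded along it. The
  -- minus sign is the extra factor in `sgn (suc j)`. The column expansion is needed only one size
  -- smaller, so the mutual recursion terminates.
  det-bordered : ∀ {n} (M : Matrix (suc n) (suc n)) →
    let M′ = minor M zero zero in
    det M ≡ M zero zero *ᶻ det M′ +ᶻ
            ∑[ i < n ] ∑[ j < n ] (- cofactor M′ i j *ᶻ (M zero (suc j) *ᶻ M (suc i) zero))
  det-bordered {zero}  M = cong (λ x → x *ᶻ 1ℤ +ᶻ 0ℤ) (ℤ.*-identityˡ (M zero zero))
  det-bordered {suc n} M = cong₂ _+ᶻ_
    (cong (_*ᶻ det (minor M zero zero)) (ℤ.*-identityˡ (M zero zero)))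
    (begin
      ∑[ j < suc n ] (sgn (suc j) *ᶻ M zero (suc j) *ᶻ det (minor M zero (suc j)))
        ≡⟨ Σ.sum-cong-≗ (λ j → trans
             (cong (sgn (suc j) *ᶻ M zero (suc j) *ᶻ_) (det-expand-column (minor M zero (suc j))))
             (trans (Σ.*-distribˡ-sum (sgn (suc j) *ᶻ M zero (suc j))
                       (λ i → M (suc i) zero *ᶻ cofactor (minor M zero (suc j)) i zero))
               (Σ.sum-cong-≗ λ i → lemma (sgn j) (M zero (suc j)) (M (suc i) zero) (sgn i)
                                         (det (minor M′ i j))))) ⟩
      ∑[ j < suc n ] ∑[ i < suc n ] h i j
        ≡⟨ Σ.∑-comm (λ j i → h i j) ⟩
      ∑[ i < suc n ] ∑[ j < suc n ] h i j
        ∎)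
    where
    M′ = minor M zero zero
    h : Fin (suc n) → Fin (suc n) → ℤ
    h i j = - cofactor M′ i j *ᶻ (M zero (suc j) *ᶻ M (suc i) zero)
    lemma : ∀ s x y t d → -1ℤ *ᶻ s *ᶻ x *ᶻ (y *ᶻ (t *ᶻ 1ℤ *ᶻ d)) ≡ - (t *ᶻ s *ᶻ d) *ᶻ (x *ᶻ y)
    lemma = solve-∀

  -- For fixed `i`, the bordered terms over `j` reassemble into the first-row expansion of
  -- `minor M (suc i) zero`.
  det-expand-column : ∀ {n} (M : Matrix (suc n) (suc n)) →
                      det M ≡ ∑[ i < suc n ] (M i zero *ᶻ cofactor M i zero)
  det-expand-column {zero}  M = lemma (M zero zero)
    where
    lemma : ∀ x → 1ℤ *ᶻ x *ᶻ 1ℤ +ᶻ 0ℤ ≡ x *ᶻ (1ℤ *ᶻ 1ℤ *ᶻ 1ℤ) +ᶻ 0ℤ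
    lemma = solve-∀
  det-expand-column {suc n} M = begin
    det M
      ≡⟨ det-bordered M ⟩
    M zero zero *ᶻ det M′ +ᶻ ∑[ i < suc n ] ∑[ j < suc n ] (- cofactor M′ i j *ᶻ (M zero (suc j) *ᶻ M (suc i) zero))
      ≡⟨ cong₂ _+ᶻ_
           (cong (M zero zero *ᶻ_) (sym (ℤ.*-identityˡ (det M′))))
           (Σ.sum-cong-≗ expand-first-row) ⟩
    ∑[ i < suc (suc n) ] (M i zero *ᶻ cofactor M i zero)
      ∎
    where
    M′ = minor M zero zero
    lemma : ∀ s x y t d → - (t *ᶻ s *ᶻ d) *ᶻ (x *ᶻ y) ≡ y *ᶻ (-1ℤ *ᶻ t *ᶻ 1ℤ) *ᶻ (s *ᶻ x *ᶻ d)
    lemma = solve-∀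
    expand-first-row : ∀ i →
      (∑[ j < suc n ] (- cofactor M′ i j *ᶻ (M zero (suc j) *ᶻ M (suc i) zero)))
        ≡ M (suc i) zero *ᶻ cofactor M (suc i) zero
    expand-first-row i = begin
      ∑[ j < suc n ] (- cofactor M′ i j *ᶻ (M zero (suc j) *ᶻ M (suc i) zero))
        ≡⟨ Σ.sum-cong-≗ (λ j → lemma (sgn j) (M zero (suc j)) (M (suc i) zero) (sgn i) (det (minor M′ i j))) ⟩
      ∑[ j < suc n ] (c *ᶻ g j)
        ≡⟨ Σ.*-distribˡ-sum c g ⟨
      c *ᶻ det (minor M (suc i) zero)
        ≡⟨ ℤ.*-assoc (M (suc i) zero) (sgn (suc i) *ᶻ 1ℤ) (det (minor M (suc i) zero)) ⟩
      M (suc i) zero *ᶻ cofactor M (suc i) zero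
        ∎
      where
      c = M (suc i) zero *ᶻ (sgn (suc i) *ᶻ 1ℤ)
      g : Fin (suc n) → ℤ
      g j = sgn j *ᶻ M zero (suc j) *ᶻ det (minor M′ i j)

-- Sums over lists

-- Has the same shape as the numerator of `E`, so that `E` unfolds to it by computation.
∑ₗ : ∀ {A : Set} → List A → (A → ℤ) → ℤ
∑ₗ xs f = foldr _+ᶻ_ 0ℤ (map f xs)

∑ₗ-cong : ∀ {A : Set} (xs : List A) {f g : A → ℤ} → (∀ x → f x ≡ g x) → ∑ₗ xs f ≡ ∑ₗ xs g
∑ₗ-cong []       f≗g = refl
∑ₗ-cong (x ∷ xs) f≗g = cong₂ _+ᶻ_ (f≗g x) (∑ₗ-cong xs f≗g)

∑ₗ-distrib-+ : ∀ {A : Set} (xs : List A) (f g : A → ℤ) →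
               ∑ₗ xs (λ x → f x +ᶻ g x) ≡ ∑ₗ xs f +ᶻ ∑ₗ xs g
∑ₗ-distrib-+ []       f g = refl
∑ₗ-distrib-+ (x ∷ xs) f g = trans
  (cong (f x +ᶻ g x +ᶻ_) (∑ₗ-distrib-+ xs f g))
  (lemma (f x) (g x) (∑ₗ xs f) (∑ₗ xs g))
  where
  lemma : ∀ a b c d → a +ᶻ b +ᶻ (c +ᶻ d) ≡ a +ᶻ c +ᶻ (b +ᶻ d)
  lemma = solve-∀

*-distribˡ-∑ₗ : ∀ {A : Set} c (xs : List A) (f : A → ℤ) →
                ∑ₗ xs (λ x → c *ᶻ f x) ≡ c *ᶻ ∑ₗ xs f
*-distribˡ-∑ₗ c []       f = sym (ℤ.*-zeroʳ c)
*-distribˡ-∑ₗ c (x ∷ xs) f = trans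
  (cong (c *ᶻ f x +ᶻ_) (*-distribˡ-∑ₗ c xs f))
  (sym (ℤ.*-distribˡ-+ c (f x) (∑ₗ xs f)))

∑ₗ-0 : ∀ {A : Set} (xs : List A) → ∑ₗ xs (λ _ → 0ℤ) ≡ 0ℤ
∑ₗ-0 []       = refl
∑ₗ-0 (x ∷ xs) = trans (ℤ.+-identityˡ _) (∑ₗ-0 xs)

∑ₗ-∑-comm : ∀ {A : Set} (xs : List A) {n} (f : A → Fin n → ℤ) →
            ∑ₗ xs (λ x → ∑[ i < n ] f x i) ≡ ∑[ i < n ] ∑ₗ xs (λ x → f x i)
∑ₗ-∑-comm xs {zero}  f = ∑ₗ-0 xs
∑ₗ-∑-comm xs {suc n} f = trans
  (∑ₗ-distrib-+ xs (λ x → f x zero) _)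
  (cong (∑ₗ xs (λ x → f x zero) +ᶻ_) (∑ₗ-∑-comm xs λ x i → f x (suc i)))

∑ₗ-++ : ∀ {A : Set} (xs ys : List A) (f : A → ℤ) →
        ∑ₗ (xs ++ ys) f ≡ ∑ₗ xs f +ᶻ ∑ₗ ys f
∑ₗ-++ []       ys f = sym (ℤ.+-identityˡ _)
∑ₗ-++ (x ∷ xs) ys f = trans (cong (f x +ᶻ_) (∑ₗ-++ xs ys f)) (sym (ℤ.+-assoc (f x) _ _))

∑ₗ-map : ∀ {A B : Set} (g : A → B) (xs : List A) (f : B → ℤ) →
         ∑ₗ (map g xs) f ≡ ∑ₗ xs (λ x → f (g x))
∑ₗ-map g []       f = refl
∑ₗ-map g (x ∷ xs) f = cong (f (g x) +ᶻ_) (∑ₗ-map g xs f)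

∑ₗ-cartesianProductWith :
  ∀ {A B C : Set} (g : A → B → C) (xs : List A) (ys : List B) (f : C → ℤ) →
  ∑ₗ (cartesianProductWith g xs ys) f ≡ ∑ₗ xs (λ x → ∑ₗ ys (λ y → f (g x y)))
∑ₗ-cartesianProductWith g []       ys f = refl
∑ₗ-cartesianProductWith g (x ∷ xs) ys f = trans
  (∑ₗ-++ (map (g x) ys) _ f)
  (cong₂ _+ᶻ_ (∑ₗ-map (g x) ys f) (∑ₗ-cartesianProductWith g xs ys f))

∑ₗ-comm : ∀ {A B : Set} (xs : List A) (ys : List B) (f : A → B → ℤ) →
          ∑ₗ xs (λ x → ∑ₗ ys (f x)) ≡ ∑ₗ ys (λ y → ∑ₗ xs (λ x → f x y))
∑ₗ-comm []       ys f = sym (∑ₗ-0 ys)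
∑ₗ-comm (x ∷ xs) ys f = trans
  (cong (∑ₗ ys (f x) +ᶻ_) (∑ₗ-comm xs ys f))
  (sym (∑ₗ-distrib-+ ys (f x) _))

-- Averaging over one random row

signVecs : ∀ n → List (Vec Sign n)
signVecs = allVecs signs

entry : ∀ {n} → Vec Sign n → Fin n → ℤ
entry v k = lookup v k ◃ 1

2^_ : ℕ → ℤ
2^ n = + (2 ^ n)

2^-suc : ∀ n → 2^ (suc n) ≡ 2^ n +ᶻ 2^ n
2^-suc n = cong (λ k → + (2 ^ n ℕ.+ k)) (ℕ.+-identityʳ (2 ^ n))

-- Pairing the two extensions of each `v` lets terms odd in the first sign cancel within a single
-- summand.
∑-signVecs-suc : ∀ n (f : Vec Sign (suc n) → ℤ) →
  ∑ₗ (signVecs (suc n)) f ≡ ∑ₗ (signVecs n) (λ v → f (Sign.+ ∷ v) +ᶻ f (Sign.- ∷ v))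
∑-signVecs-suc n f = begin
  ∑ₗ (signVecs (suc n)) f
    ≡⟨ ∑ₗ-cartesianProductWith _∷_ signs (signVecs n) f ⟩
  a +ᶻ (b +ᶻ 0ℤ)
    ≡⟨ cong (a +ᶻ_) (ℤ.+-identityʳ b) ⟩
  a +ᶻ b
    ≡⟨ ∑ₗ-distrib-+ (signVecs n) _ _ ⟨
  ∑ₗ (signVecs n) (λ v → f (Sign.+ ∷ v) +ᶻ f (Sign.- ∷ v))
    ∎
  where
  a = ∑ₗ (signVecs n) (λ v → f (Sign.+ ∷ v))
  b = ∑ₗ (signVecs n) (λ v → f (Sign.- ∷ v))

∑-signVecs-const : ∀ n c → ∑ₗ (signVecs n) (λ _ → c) ≡ 2^ n *ᶻ c
∑-signVecs-const zero    c = trans (ℤ.+-identityʳ c) (sym (ℤ.*-identityˡ c))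
∑-signVecs-const (suc n) c = begin
  ∑ₗ (signVecs (suc n)) (λ _ → c)        ≡⟨ ∑-signVecs-suc n (λ _ → c) ⟩
  ∑ₗ (signVecs n) (λ _ → c +ᶻ c)        ≡⟨ ∑-signVecs-const n (c +ᶻ c) ⟩
  2^ n *ᶻ (c +ᶻ c)                     ≡⟨ lemma (2^ n) c ⟩
  (2^ n +ᶻ 2^ n) *ᶻ c                  ≡⟨ cong (_*ᶻ c) (2^-suc n) ⟨
  2^ (suc n) *ᶻ c                       ∎
  where
  lemma : ∀ p x → p *ᶻ (x +ᶻ x) ≡ (p +ᶻ p) *ᶻ x
  lemma = solve-∀

-- Distinct signs are uncorrelated and each squares to 1. The order of the factors matches the two
-- border entries of `gram (r ∷ B)`.
∑-signVecs-bilinear : ∀ n (x y : Fin n → ℤ) →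
  ∑ₗ (signVecs n) (λ v → (∑[ k < n ] (entry v k *ᶻ x k)) *ᶻ (∑[ k < n ] (y k *ᶻ entry v k)))
    ≡ 2^ n *ᶻ ∑[ k < n ] (y k *ᶻ x k)
∑-signVecs-bilinear zero    x y = refl
∑-signVecs-bilinear (suc n) x y = begin
  ∑ₗ (signVecs (suc n)) (λ v → (∑[ k < suc n ] (entry v k *ᶻ x k)) *ᶻ (∑[ k < suc n ] (y k *ᶻ entry v k)))
    ≡⟨ ∑-signVecs-suc n _ ⟩
  ∑ₗ (signVecs n) (λ v →
    (1ℤ *ᶻ x₀ +ᶻ p v) *ᶻ (y₀ *ᶻ 1ℤ +ᶻ q v) +ᶻ (-1ℤ *ᶻ x₀ +ᶻ p v) *ᶻ (y₀ *ᶻ -1ℤ +ᶻ q v))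
    -- The cross terms between the first coordinate and the rest cancel.
    ≡⟨ ∑ₗ-cong (signVecs n) (λ v → parallelogram x₀ y₀ (p v) (q v)) ⟩
  ∑ₗ (signVecs n) (λ v → + 2 *ᶻ (y₀ *ᶻ x₀) +ᶻ + 2 *ᶻ (p v *ᶻ q v))
    ≡⟨ ∑ₗ-distrib-+ (signVecs n) _ _ ⟩
  ∑ₗ (signVecs n) (λ _ → + 2 *ᶻ (y₀ *ᶻ x₀)) +ᶻ ∑ₗ (signVecs n) (λ v → + 2 *ᶻ (p v *ᶻ q v))
    ≡⟨ cong₂ _+ᶻ_ (∑-signVecs-const n _)
         (trans (*-distribˡ-∑ₗ (+ 2) (signVecs n) _)
                (cong (+ 2 *ᶻ_) (∑-signVecs-bilinear n (λ k → x (suc k)) (λ k → y (suc k))))) ⟩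
  2^ n *ᶻ (+ 2 *ᶻ (y₀ *ᶻ x₀)) +ᶻ + 2 *ᶻ (2^ n *ᶻ z)
    ≡⟨ collect (2^ n) (y₀ *ᶻ x₀) z ⟩
  (2^ n +ᶻ 2^ n) *ᶻ (y₀ *ᶻ x₀ +ᶻ z)
    ≡⟨ cong (_*ᶻ (y₀ *ᶻ x₀ +ᶻ z)) (2^-suc n) ⟨
  2^ (suc n) *ᶻ ∑[ k < suc n ] (y k *ᶻ x k)
    ∎
  where
  x₀ = x zero
  y₀ = y zero
  z = ∑[ k < n ] (y (suc k) *ᶻ x (suc k))
  p q : Vec Sign n → ℤ
  p v = ∑[ k < n ] (entry v k *ᶻ x (suc k))
  q v = ∑[ k < n ] (y (suc k) *ᶻ entry v k)
  parallelogram : ∀ a b c d →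
    (1ℤ *ᶻ a +ᶻ c) *ᶻ (b *ᶻ 1ℤ +ᶻ d) +ᶻ (-1ℤ *ᶻ a +ᶻ c) *ᶻ (b *ᶻ -1ℤ +ᶻ d)
      ≡ + 2 *ᶻ (b *ᶻ a) +ᶻ + 2 *ᶻ (c *ᶻ d)
  parallelogram = solve-∀
  collect : ∀ w a c → w *ᶻ (+ 2 *ᶻ a) +ᶻ + 2 *ᶻ (w *ᶻ c) ≡ (w +ᶻ w) *ᶻ (a +ᶻ c)
  collect = solve-∀

entry² : ∀ s → (s ◃ 1) *ᶻ (s ◃ 1) ≡ 1ℤ
entry² Sign.+ = refl
entry² Sign.- = refl

∑-const : ∀ n c → ∑[ i < n ] c ≡ + n *ᶻ c
∑-const zero    c = refl
∑-const (suc n) c = trans (cong (c +ᶻ_) (∑-const n c)) (sym (ℤ.suc-* (+ n) c))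

gram : ∀ {m n} → SignMatrix m n → Matrix m m
gram B = toMatrix B · toMatrix B ᵀ

gram-diagonal : ∀ {m n} (B : SignMatrix m n) i → gram B i i ≡ + n
gram-diagonal {n = n} B i = begin
  gram B i i       ≡⟨ Σ.sum-cong-≗ (λ k → entry² (lookup (lookup B i) k)) ⟩
  ∑[ k < n ] 1ℤ    ≡⟨ ∑-const n 1ℤ ⟩
  + n *ᶻ 1ℤ       ≡⟨ ℤ.*-identityʳ (+ n) ⟩
  + n              ∎

-- Deleting the first row and column of `gram (r ∷ B)` gives `gram B` by computation, so `r` enters
-- only through the border.
∑-det-gram-∷ : ∀ {m n} (B : SignMatrix m n) →
  ∑ₗ (signVecs n) (λ r → det (gram (r ∷ B))) ≡ 2^ n *ᶻ ((+ n - + m) *ᶻ det (gram B))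
∑-det-gram-∷ {m} {n} B = begin
  ∑ₗ (signVecs n) (λ r → det (gram (r ∷ B)))
    ≡⟨ ∑ₗ-cong (signVecs n) (λ r → trans (det-bordered (gram (r ∷ B)))
         (cong (λ d → d *ᶻ D +ᶻ ∑[ i < m ] ∑[ j < m ] h r i j) (gram-diagonal (r ∷ B) zero))) ⟩
  ∑ₗ (signVecs n) (λ r → + n *ᶻ D +ᶻ ∑[ i < m ] ∑[ j < m ] h r i j)
    ≡⟨ ∑ₗ-distrib-+ (signVecs n) _ _ ⟩
  ∑ₗ (signVecs n) (λ r → + n *ᶻ D) +ᶻ ∑ₗ (signVecs n) (λ r → ∑[ i < m ] ∑[ j < m ] h r i j)
    ≡⟨ cong₂ _+ᶻ_ (∑-signVecs-const n (+ n *ᶻ D)) (begin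
         ∑ₗ (signVecs n) (λ r → ∑[ i < m ] ∑[ j < m ] h r i j)
           ≡⟨ ∑ₗ-∑-comm (signVecs n) (λ r i → ∑[ j < m ] h r i j) ⟩
         ∑[ i < m ] ∑ₗ (signVecs n) (λ r → ∑[ j < m ] h r i j)
           ≡⟨ Σ.sum-cong-≗ (λ i → trans (∑ₗ-∑-comm (signVecs n) (λ r → h r i)) (Σ.sum-cong-≗ (∑-h i))) ⟩
         ∑[ i < m ] ∑[ j < m ] (- 2^ n *ᶻ (G i j *ᶻ cofactor G i j))
           ≡⟨ Σ.sum-cong-≗ (λ i → trans
                (sym (Σ.*-distribˡ-sum (- 2^ n) (λ j → G i j *ᶻ cofactor G i j)))
                (cong (- 2^ n *ᶻ_) (sym (det-expand-row G i)))) ⟩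
         ∑[ i < m ] (- 2^ n *ᶻ D)
           ≡⟨ ∑-const m _ ⟩
         + m *ᶻ (- 2^ n *ᶻ D)
           ∎) ⟩
  2^ n *ᶻ (+ n *ᶻ D) +ᶻ + m *ᶻ (- 2^ n *ᶻ D)
    ≡⟨ collect (2^ n) (+ n) (+ m) D ⟩
  2^ n *ᶻ ((+ n - + m) *ᶻ D)
    ∎
  where
  G = gram B
  D = det G
  h : Vec Sign n → Fin m → Fin m → ℤ
  h r i j = - cofactor G i j *ᶻ (gram (r ∷ B) zero (suc j) *ᶻ gram (r ∷ B) (suc i) zero)
  regroup : ∀ c w g → - c *ᶻ (w *ᶻ g) ≡ - w *ᶻ (g *ᶻ c)
  regroup = solve-∀
  ∑-h : ∀ i j → ∑ₗ (signVecs n) (λ r → h r i j) ≡ - 2^ n *ᶻ (G i j *ᶻ cofactor G i j)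
  ∑-h i j = begin
    ∑ₗ (signVecs n) (λ r → h r i j)
      ≡⟨ *-distribˡ-∑ₗ (- cofactor G i j) (signVecs n) _ ⟩
    - cofactor G i j *ᶻ ∑ₗ (signVecs n) (λ r → gram (r ∷ B) zero (suc j) *ᶻ gram (r ∷ B) (suc i) zero)
      ≡⟨ cong (- cofactor G i j *ᶻ_) (∑-signVecs-bilinear n (toMatrix B j) (toMatrix B i)) ⟩
    - cofactor G i j *ᶻ (2^ n *ᶻ G i j)
      ≡⟨ regroup (cofactor G i j) (2^ n) (G i j) ⟩
    - 2^ n *ᶻ (G i j *ᶻ cofactor G i j)
      ∎
  collect : ∀ w a b d → w *ᶻ (a *ᶻ d) +ᶻ b *ᶻ (- w *ᶻ d) ≡ w *ᶻ ((a - b) *ᶻ d)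
  collect = solve-∀

-- Falling factorials and binomial coefficients

-- n P′ k is a product of truncated differences n ∸ i, so it vanishes for k > n.

P′-zero : ∀ {n k} → n ℕ.< k → n P′ k ≡ 0
P′-zero {n} {suc k} (s≤s n≤k) = cong (ℕ._* (n P′ k)) (ℕ.m≤n⇒m∸n≡0 n≤k)

-- Truncated and integer subtraction agree for `k ≤ n`; beyond that the factor `n P′ k` vanishes on
-- both sides.
P′-suc : ∀ n k → + (n P′ suc k) ≡ (+ n - + k) *ᶻ + (n P′ k)
P′-suc n k with ℕ.≤-<-connex k n
... | inj₁ k≤n = begin
  + ((n ∸ k) ℕ.* (n P′ k))        ≡⟨ ℤ.pos-* (n ∸ k) (n P′ k) ⟩
  + (n ∸ k) *ᶻ + (n P′ k)        ≡⟨ cong (_*ᶻ + (n P′ k)) (ℤ.⊖-≥ k≤n) ⟨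
  (n ℤ.⊖ k) *ᶻ + (n P′ k)        ≡⟨ cong (_*ᶻ + (n P′ k)) (ℤ.m-n≡m⊖n n k) ⟨
  (+ n - + k) *ᶻ + (n P′ k)    ∎
... | inj₂ n<k = begin
  + ((n ∸ k) ℕ.* (n P′ k))        ≡⟨ cong (λ p → + ((n ∸ k) ℕ.* p)) (P′-zero n<k) ⟩
  + ((n ∸ k) ℕ.* 0)               ≡⟨ cong +_ (ℕ.*-zeroʳ (n ∸ k)) ⟩
  0ℤ                              ≡⟨ ℤ.*-zeroʳ (+ n - + k) ⟨
  (+ n - + k) *ᶻ 0ℤ            ≡⟨ cong (λ p → (+ n - + k) *ᶻ + p) (P′-zero n<k) ⟨
  (+ n - + k) *ᶻ + (n P′ k)    ∎

P≡P′ : ∀ {n k} → k ≤ n → n P k ≡ n P′ k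
-- `n P k` branches on the boolean test `k ≤ᵇ n`; abstracting it together with its proof leaves only
-- the `true` branch.
P≡P′ {n} {k} k≤n with k ℕ.≤ᵇ n | ℕ.≤⇒≤ᵇ k≤n
... | true | _ = refl

-- For `k ≤ n` the division by `k !` that computes `n C k` is exact; for `k > n` both sides are
-- zero.
k!*nCk≡nP′k : ∀ n k → k ! * (n C k) ≡ n P′ k
k!*nCk≡nP′k n k with ℕ.≤-<-connex k n
... | inj₁ k≤n = begin
  k ! * (n C k)              ≡⟨ cong (k ! *_) (nCk≡nPk/k! k≤n) ⟩
  k ! * ((n P k) ℕ./ k !)    ≡⟨ cong (λ p → k ! * (p ℕ./ k !)) (P≡P′ k≤n) ⟩
  k ! * ((n P′ k) ℕ./ k !)   ≡⟨ m*[n/m]≡n (k!∣nP′k k≤n) ⟩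
  n P′ k                     ∎
  where instance _ = k ℕ.!≢0
... | inj₂ n<k = begin
  k ! * (n C k)    ≡⟨ cong (k ! *_) (k>n⇒nCk≡0 n<k) ⟩
  k ! * 0          ≡⟨ ℕ.*-zeroʳ (k !) ⟩
  0                ≡⟨ P′-zero n<k ⟨
  n P′ k           ∎

-- The expectation, by induction on the number of rows

∑-det-gram : ∀ m n → ∑ₗ (allSignMatrices m n) (λ B → det (gram B)) ≡ 2^ (m * n) *ᶻ + (n P′ m)
∑-det-gram zero    n = refl
∑-det-gram (suc m) n = begin
  ∑ₗ (allSignMatrices (suc m) n) (λ B → det (gram B))
    ≡⟨ ∑ₗ-cartesianProductWith _∷_ (signVecs n) Bs _ ⟩
  ∑ₗ (signVecs n) (λ r → ∑ₗ Bs (λ B → det (gram (r ∷ B))))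
    -- The new row must be summed first, with the other rows held fixed.
    ≡⟨ ∑ₗ-comm (signVecs n) Bs _ ⟩
  ∑ₗ Bs (λ B → ∑ₗ (signVecs n) (λ r → det (gram (r ∷ B))))
    ≡⟨ ∑ₗ-cong Bs (λ B → trans (∑-det-gram-∷ B) (sym (ℤ.*-assoc (2^ n) (+ n - + m) _))) ⟩
  ∑ₗ Bs (λ B → 2^ n *ᶻ (+ n - + m) *ᶻ det (gram B))
    ≡⟨ *-distribˡ-∑ₗ (2^ n *ᶻ (+ n - + m)) Bs _ ⟩
  2^ n *ᶻ (+ n - + m) *ᶻ ∑ₗ Bs (λ B → det (gram B))
    ≡⟨ cong (2^ n *ᶻ (+ n - + m) *ᶻ_) (∑-det-gram m n) ⟩
  2^ n *ᶻ (+ n - + m) *ᶻ (2^ (m * n) *ᶻ + (n P′ m))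
    ≡⟨ regroup (2^ n) (+ n - + m) (2^ (m * n)) (+ (n P′ m)) ⟩
  2^ n *ᶻ 2^ (m * n) *ᶻ ((+ n - + m) *ᶻ + (n P′ m))
    ≡⟨ cong₂ _*ᶻ_ 2^-+ (sym (P′-suc n m)) ⟩
  2^ (suc m * n) *ᶻ + (n P′ suc m)
    ∎
  where
  Bs = allSignMatrices m n
  regroup : ∀ a b c d → a *ᶻ b *ᶻ (c *ᶻ d) ≡ a *ᶻ c *ᶻ (b *ᶻ d)
  regroup = solve-∀
  2^-+ : 2^ n *ᶻ 2^ (m * n) ≡ 2^ (suc m * n)
  2^-+ = trans (sym (ℤ.pos-* (2 ^ n) (2 ^ (m * n))))
               (cong +_ (sym (ℕ.^-distribˡ-+-* 2 n (m * n))))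

-- `_/_` reduces to lowest terms; passing to unnormalised rationals leaves only a
-- cross-multiplication.
[d*z]/d≡z/1 : ∀ d .{{_ : NonZero d}} z → (+ d *ᶻ z) / d ≡ z / 1
-- `mkℚᵘ` stores the denominator minus one, so `d` and `0` encode `suc d` and `1`.
[d*z]/d≡z/1 (suc d) z = ℚ.fromℚᵘ-cong {mkℚᵘ (+ suc d *ᶻ z) d} {mkℚᵘ z 0}
  (*≡* (trans (ℤ.*-identityʳ (+ suc d *ᶻ z)) (ℤ.*-comm (+ suc d) z)))

theorem2 : (m n : ℕ) .{{_ : NonZero m}} .{{_ : NonZero n}} →
    E {m} {n} (λ B → det (toMatrix B · toMatrix B ᵀ)) ≡ (+ (m ! * (n C m))) / 1
theorem2 m n = begin
  (∑ₗ (allSignMatrices m n) (λ B → det (gram B))) / (2 ^ (m * n))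
    ≡⟨ cong (_/ (2 ^ (m * n))) (∑-det-gram m n) ⟩
  (2^ (m * n) *ᶻ + (n P′ m)) / (2 ^ (m * n))
    ≡⟨ [d*z]/d≡z/1 (2 ^ (m * n)) (+ (n P′ m)) ⟩
  + (n P′ m) / 1
    ≡⟨ cong (λ p → + p / 1) (k!*nCk≡nP′k n m) ⟨
  + (m ! * (n C m)) / 1
    ∎
  where instance _ = ℕ.m^n≢0 2 (m * n)
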